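{- Let $k,d,n$ be integers with $3\le k\le d+1$ and $n\ge 3$. If $k=3$ and $n=4$, then $\omega^3_d(C_4)=4$. Otherwise, \[\omega^k_d(C_n)=\begin{cases} n&\text{if } n\le k-1,\\ k-1&\text{if } n\ge k\text{ and }\lfloor n/2\rfloor+1\le k-1,\\ \min\left(\lfloor n/2\rfloor+1,\,d+1\right)&\text{if }\lfloor n/2\rfloor+1>k-1.\end{cases}\] Equivalently (still excluding the case $k=3$, $n=4$), \[\omega^k_d(C_n)=\begin{cases} n&\text{if } n\le k-1,\\ k-1&\text{if } k\le n\le 2k-3,\\ \lfloor n/2\rfloor+1&\text{if } 2k-2\le n\le 2d-1,\\ d+1&\text{if } n\ge 2d.\end{cases}\]
   Context: $C_n$ is the cycle graph on $n$ vertices. A shortest path in a graph $G$ is a path between some vertices $u,v$ whose length (number of edges) equals the graph distance between $u$ and $v$. A set $S\subseteq V(G)$ is a $k,d$-clique in $G$ if every $k$-element subset of $S$ is contained in some shortest path of $G$ of length at most $d$ (sets with fewer than $k$ elements are vacuously $k,d$-cliques). $\omega^k_d(G)$ is the supremum of the sizes of $k,d$-cliques in $G$. -}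

module Defs where

open import Data.Fin using (Fin; toℕ)
open import Data.Fin.Subset using (Subset; _∈_; _⊆_; ∣_∣)
open import Data.List using (List; []; _∷_)
import Data.List.Membership.Propositional as List
open import Data.List.Relation.Unary.Unique.Propositional using (Unique)
open import Data.Nat using (ℕ; suc; _≤_; s≤s)
open import Data.Nat.Properties using (1+n≢n)
open import Data.Product using (Σ; ∃-syntax; _×_; _,_)
open import Data.Sum using (_⊎_; inj₁; inj₂; swap; [_,_]′)
open import Relation.Binary.Construct.Closure.ReflexiveTransitive using (Star; ε; _◅_)
open import Relation.Binary.Definitions using (Symmetric)
open import Relation.Binary.PropositionalEquality using (_≡_; refl; sym; trans; cong)
open import Relation.Nullary using (¬_)

record Graph (n : ℕ) : Set₁ where
  field
    Adj    : Fin n → Fin n → Set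
    symm   : Symmetric Adj
    irrefl : ∀ {v} → ¬ Adj v v

module _ {n : ℕ} (G : Graph n) where
  open Graph G

  Walk : Fin n → Fin n → Set
  Walk = Star Adj

  vertices : ∀ {u v} → Walk u v → List (Fin n)
  vertices {u} ε        = u ∷ []
  vertices {u} (_ ◅ w)  = u ∷ vertices w

  length : ∀ {u v} → Walk u v → ℕ
  length ε       = 0
  length (_ ◅ w) = suc (length w)

  IsPath : ∀ {u v} → Walk u v → Set
  IsPath w = Unique (vertices w)

  -- The distance is a relation, not a function: it has no value when u and v
  -- are not connected.
  IsDistance : Fin n → Fin n → ℕ → Set
  IsDistance u v m =
    (∃[ w ] IsPath {u} {v} w × length w ≡ m) ×
    (∀ (w : Walk u v) → IsPath w → m ≤ length w)

  IsShortestPath : ∀ {u v} → Walk u v → Set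
  IsShortestPath {u} {v} w = IsPath w × IsDistance u v (length w)

  IsClique : (k d : ℕ) → Subset n → Set
  IsClique k d S = ∀ (T : Subset n) → T ⊆ S → ∣ T ∣ ≡ k →
    ∃[ u ] ∃[ v ] Σ (Walk u v) λ w →
      IsShortestPath w × length w ≤ d × (∀ {x} → x ∈ T → x List.∈ vertices w)

IsSupremum : (ℕ → Set) → ℕ → Set
IsSupremum P m =
  (∀ {s} → P s → s ≤ m) ×
  (∀ b → (∀ {s} → P s → s ≤ b) → m ≤ b)

-- ω^k_d(G) = m. The vertex set is finite, so every clique is a Subset and its
-- size a natural number.
IsOmega : (k d : ℕ) {n : ℕ} → Graph n → ℕ → Set
IsOmega k d G m = IsSupremum (λ s → ∃[ S ] IsClique G k d S × ∣ S ∣ ≡ s) m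

-- j follows i in the cyclic order 0, 1, …, n - 1, 0.
Next : ∀ {n} → Fin n → Fin n → Set
Next {n} i j = toℕ j ≡ suc (toℕ i) ⊎ (suc (toℕ i) ≡ n × toℕ j ≡ 0)

cycle : (n : ℕ) → 3 ≤ n → Graph n
cycle n 3≤n = record
  { Adj    = λ i j → Next i j ⊎ Next j i
  ; symm   = swap
  ; irrefl = λ {v} → [ next-irrefl 3≤n v , next-irrefl 3≤n v ]′
  }
  where
  1≢n : ∀ {n} → 3 ≤ n → ¬ 1 ≡ n
  1≢n (s≤s ()) refl

  next-irrefl : ∀ {n} → 3 ≤ n → (v : Fin n) → ¬ Next v v
  next-irrefl _   v (inj₁ eq)          = 1+n≢n (sym eq)
  next-irrefl 3≤n v (inj₂ (eq , v≡0)) = 1≢n 3≤n (trans (cong suc (sym v≡0)) eq)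

-- In a walk of length ℓ all vertices lie on an arc of ℓ + 1 consecutive vertices,
-- so with m = min (⌊ n /2⌋ , d) every k-subset of a clique S lies on an arc of
-- length m. If ∣ S ∣ ≥ k, then so does every triple of S: one of the three gaps of
-- the triple is at least n - m. Take b, c in S whose clockwise offset is at most m
-- and as large as possible. A vertex x of S outside the arc of length m from b
-- makes the gap from c to x at least n - m, and then (x , c) beats (b , c), unless b
-- and c are antipodal (n = 2m). In that case any x and y in S strictly on the two
-- sides of {b , c} are antipodal, so ∣ S ∣ ≤ 4, which is at most m + 1 except for
-- n = 4. Arcs of length m are shortest paths and give the matching lower bound.

module Submission where

open import Defs
open import Data.Nat using (ℕ; _+_; _*_; _∸_; _≤_; _>_; _≥_; _⊓_; ⌊_/2⌋)
open import Data.Product using (_×_)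
open import Relation.Binary.PropositionalEquality using (_≡_)
open import Relation.Nullary using (¬_)

open import Data.Bool using (true; false)
open import Data.Empty using (⊥-elim)
open import Data.Fin using (Fin; zero; suc; toℕ; fromℕ<)
open import Data.Fin.Properties using (toℕ-injective; toℕ-fromℕ<; toℕ<n; any?)
open import Data.Fin.Subset using (Subset; _∈_; _⊆_; ∣_∣; _∪_; ⁅_⁆; ⊤; ⊥)
open import Data.Fin.Subset.Properties
  using (_∈?_; nonempty?; ∉⊥; ⊥⊆; ∣⊤∣≡n; ∣⊥∣≡0; ∣p∣≤n; p⊆q⇒∣p∣≤∣q∣; Empty-unique;
         x∈⁅x⁆; x∈⁅y⁆⇒x≡y; ∣⁅x⁆∣≡1; x∈p∪q⁺; x∈p∪q⁻; drop-∷-⊆; out⊆; in⊆in)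
open import Data.List using (applyDownFrom)
open import Data.List.Membership.Propositional.Properties using (∈-applyDownFrom⁺)
open import Data.List.Relation.Unary.Any using (here; there)
import Data.List.Membership.Propositional as List
open import Data.List.Relation.Unary.Unique.Propositional using (Unique)
open import Data.List.Relation.Unary.Unique.Propositional.Properties using (applyDownFrom⁺₁)
open import Data.Nat using (zero; suc; z≤n; s≤s; _<_; NonZero; _%_; _/_; >-nonZero; s≤s⁻¹)
open import Data.Nat.DivMod using (m%n<n; m≡m%n+[m/n]*n; [m+kn]%n≡m%n; m<n⇒m%n≡m; m%n≤m)
open import Data.Nat.Properties
open import Data.Nat.Tactic.RingSolver using (solve)
open import Data.Product using (Σ; ∃-syntax; _,_)
open import Data.Sum using (_⊎_; inj₁; inj₂; [_,_]′)
open import Function using (_∘_)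
open import Relation.Binary.Construct.Closure.ReflexiveTransitive using (ε; _◅_)
open import Relation.Binary.Definitions using (tri<; tri≈; tri>)
open import Relation.Binary.PropositionalEquality
  using (_≢_; refl; sym; trans; cong; cong₂; subst; subst₂)
open import Relation.Nullary using (yes; no; contradiction)
open import Relation.Nullary.Decidable using (_×-dec_)

-- Derives x ≤ y from a sum a ≤ b of hypotheses by a semiring identity.
linear : ∀ {a b x y} → a ≤ b → x + b ≡ y + a → x ≤ y
linear {b = b} {x} {y} a≤b eq =
  +-cancelʳ-≤ b x y (≤-trans (≤-reflexive eq) (+-monoʳ-≤ y a≤b))

-- Subsets of a finite set: cardinalities and interpolation.

module _ where

  open import Data.Vec using ([]; _∷_; here; there)

  ∣p∪q∣≤∣p∣+∣q∣ : ∀ {n} (p q : Subset n) → ∣ p ∪ q ∣ ≤ ∣ p ∣ + ∣ q ∣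
  ∣p∪q∣≤∣p∣+∣q∣ []          []          = z≤n
  ∣p∪q∣≤∣p∣+∣q∣ (false ∷ p) (false ∷ q) = ∣p∪q∣≤∣p∣+∣q∣ p q
  ∣p∪q∣≤∣p∣+∣q∣ (true ∷ p)  (false ∷ q) = s≤s (∣p∪q∣≤∣p∣+∣q∣ p q)
  ∣p∪q∣≤∣p∣+∣q∣ (false ∷ p) (true ∷ q)  =
    ≤-trans (s≤s (∣p∪q∣≤∣p∣+∣q∣ p q)) (≤-reflexive (sym (+-suc ∣ p ∣ ∣ q ∣)))
  ∣p∪q∣≤∣p∣+∣q∣ (true ∷ p)  (true ∷ q)  =
    s≤s (≤-trans (∣p∪q∣≤∣p∣+∣q∣ p q) (+-monoʳ-≤ ∣ p ∣ (n≤1+n ∣ q ∣)))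

  ∣⁅x⁆∪p∣≤1+∣p∣ : ∀ {n} (x : Fin n) (p : Subset n) → ∣ ⁅ x ⁆ ∪ p ∣ ≤ suc ∣ p ∣
  ∣⁅x⁆∪p∣≤1+∣p∣ x p =
    ≤-trans (∣p∪q∣≤∣p∣+∣q∣ ⁅ x ⁆ p) (≤-reflexive (cong (_+ ∣ p ∣) (∣⁅x⁆∣≡1 x)))

  ∈-⁅⁆∪ : ∀ {n} {x y : Fin n} {p} → x ≡ y ⊎ x ∈ p → x ∈ ⁅ y ⁆ ∪ p
  ∈-⁅⁆∪ (inj₁ refl) = x∈p∪q⁺ (inj₁ (x∈⁅x⁆ _))
  ∈-⁅⁆∪ (inj₂ x∈p)  = x∈p∪q⁺ (inj₂ x∈p)

  ⁅⁆∪-⊆ : ∀ {n} {y : Fin n} {p q} → y ∈ q → p ⊆ q → ⁅ y ⁆ ∪ p ⊆ q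
  ⁅⁆∪-⊆ {y = y} {p} y∈q p⊆q x∈ with x∈p∪q⁻ ⁅ y ⁆ p x∈
  ... | inj₁ x∈⁅y⁆ = subst (_∈ _) (sym (x∈⁅y⁆⇒x≡y y x∈⁅y⁆)) y∈q
  ... | inj₂ x∈p   = p⊆q x∈p

  -- Extends a triple of a clique to a `k`-subset, to which the clique condition applies; with `A`
  -- empty it just picks a `k`-subset.
  interpolate : ∀ {n} (A S : Subset n) k → A ⊆ S → ∣ A ∣ ≤ k → k ≤ ∣ S ∣ →
    ∃[ T ] A ⊆ T × T ⊆ S × ∣ T ∣ ≡ k
  interpolate []          []          zero    A⊆S _   _   = [] , A⊆S , A⊆S , refl
  interpolate (true ∷ A)  (false ∷ S) k       A⊆S _   _   with () ← A⊆S here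
  interpolate (true ∷ A)  (true ∷ S)  (suc k) A⊆S (s≤s A≤k) (s≤s k≤S)
    with T , A⊆T , T⊆S , ∣T∣≡k ← interpolate A S k (drop-∷-⊆ A⊆S) A≤k k≤S =
    true ∷ T , in⊆in A⊆T , in⊆in T⊆S , cong suc ∣T∣≡k
  interpolate (false ∷ A) (false ∷ S) k       A⊆S A≤k k≤S
    with T , A⊆T , T⊆S , ∣T∣≡k ← interpolate A S k (drop-∷-⊆ A⊆S) A≤k k≤S =
    false ∷ T , out⊆ A⊆T , out⊆ T⊆S , ∣T∣≡k
  interpolate (false ∷ A) (true ∷ S)  k       A⊆S A≤k k≤1+S with m≤n⇒m<n∨m≡n k≤1+S
  ... | inj₂ k≡1+S = true ∷ S , A⊆S , (λ x∈S → x∈S) , sym k≡1+S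
  ... | inj₁ (s≤s k≤S)
    with T , A⊆T , T⊆S , ∣T∣≡k ← interpolate A S k (drop-∷-⊆ A⊆S) A≤k k≤S =
    false ∷ T , out⊆ A⊆T , out⊆ T⊆S , ∣T∣≡k

  initialSegment : ∀ {n} m → m ≤ n → ∃[ S ] ∣ S ∣ ≡ m × (∀ {x : Fin n} → x ∈ S → toℕ x < m)
  initialSegment {n} zero z≤n = ⊥ , ∣⊥∣≡0 n , λ x∈⊥ → ⊥-elim (∉⊥ x∈⊥)
  initialSegment (suc m) (s≤s m≤n) with S , ∣S∣≡m , S<m ← initialSegment m m≤n =
    true ∷ S , cong suc ∣S∣≡m , λ { here → s≤s z≤n ; (there x∈S) → s≤s (S<m x∈S) }

  missingElement : ∀ {n} (S : Subset n) → ∣ S ∣ < n → ∃[ x ] ¬ x ∈ S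
  missingElement (false ∷ S) _         = zero , λ ()
  missingElement (true ∷ S)  (s≤s S<n) with x , x∉S ← missingElement S S<n =
    suc x , λ { (there x∈S) → x∉S x∈S }

-- Congruence modulo `n`, offsets and arcs in the cyclic order.

module Cyclic (n : ℕ) .{{_ : NonZero n}} where

  open import Data.List using ([]; _∷_)

  infix 4 _≈_

  -- Congruence modulo `n`; adding multiples of `n` on both sides avoids subtraction.
  record _≈_ (a b : ℕ) : Set where
    constructor mk≈
    field
      x y : ℕ
      eq  : a + x * n ≡ b + y * n

  ≈-refl : ∀ {a} → a ≈ a
  ≈-refl = mk≈ 0 0 refl

  ≈-reflexive : ∀ {a b} → a ≡ b → a ≈ b
  ≈-reflexive refl = ≈-refl

  ≈-sym : ∀ {a b} → a ≈ b → b ≈ a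
  ≈-sym (mk≈ x y eq) = mk≈ y x (sym eq)

  +-cong-≈ : ∀ {a b c d} → a ≈ b → c ≈ d → a + c ≈ b + d
  +-cong-≈ {a} {b} {c} {d} (mk≈ x y p) (mk≈ u v q) = mk≈ (x + u) (y + v)
    (trans (regroup a c x u) (trans (cong₂ _+_ p q) (sym (regroup b d y v))))
    where
    regroup : ∀ a c x u → a + c + (x + u) * n ≡ a + x * n + (c + u * n)
    regroup a c x u = solve (a ∷ c ∷ x ∷ u ∷ n ∷ [])

  +-cancelˡ-≈ : ∀ c {a b} → c + a ≈ c + b → a ≈ b
  +-cancelˡ-≈ c {a} {b} (mk≈ x y p) = mk≈ x y (+-cancelˡ-≡ c _ _
    (trans (sym (+-assoc c a (x * n))) (trans p (+-assoc c b (y * n)))))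

  -- Adding the two congruences gives `b + a ≈ b + c`, and `b` cancels.
  ≈-trans : ∀ {a b c} → a ≈ b → b ≈ c → a ≈ c
  ≈-trans {a} {b} {c} p q =
    +-cancelˡ-≈ b (subst (_≈ b + c) (+-comm a b) (+-cong-≈ p q))

  +n-≈ : ∀ a → a + n ≈ a
  +n-≈ a = mk≈ 0 1 (solve (a ∷ n ∷ []))

  %-≈ : ∀ a → a % n ≈ a
  %-≈ a = mk≈ (a / n) 0 (trans (sym (m≡m%n+[m/n]*n a n)) (sym (+-identityʳ a)))

  ≈⇒%≡ : ∀ {a b} → a ≈ b → a % n ≡ b % n
  ≈⇒%≡ {a} {b} (mk≈ x y p) =
    trans (sym ([m+kn]%n≡m%n a x n)) (trans (cong (_% n) p) ([m+kn]%n≡m%n b y n))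

  ≈-∸ : ∀ {e i j a b} → e + i ≈ a → e + j ≈ b → i ≤ j → a + (j ∸ i) ≈ b
  ≈-∸ {e} {i} e+i≈a e+j≈b i≤j = ≈-trans (+-cong-≈ (≈-sym e+i≈a) ≈-refl)
    (≈-trans (≈-reflexive (trans (+-assoc e i _) (cong (e +_) (m+[n∸m]≡n i≤j)))) e+j≈b)

  ≈∧<⇒≡ : ∀ {a b} → a ≈ b → a < n → b < n → a ≡ b
  ≈∧<⇒≡ a≈b a<n b<n = trans (sym (m<n⇒m%n≡m a<n)) (trans (≈⇒%≡ a≈b) (m<n⇒m%n≡m b<n))

  -- The difference is a positive multiple of `n`: `a < b` forces `y < x` in the witnessing
  -- equation.
  ≈∧<⇒+n≤ : ∀ {a b} → a ≈ b → a < b → a + n ≤ b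
  ≈∧<⇒+n≤ {a} {b} (mk≈ x y p) a<b = linear (+-mono-≤ 1+y*n≤x*n (≤-reflexive p))
    (solve (a ∷ b ∷ x ∷ y ∷ n ∷ []))
    where
    y<x : y < x
    y<x = *-cancelʳ-< n y x (linear (+-mono-≤ a<b (≤-reflexive (sym p)))
      (solve (a ∷ b ∷ x ∷ y ∷ n ∷ [])))

    1+y*n≤x*n : suc y * n ≤ x * n
    1+y*n≤x*n = *-monoˡ-≤ n y<x

  ≈∧<2n⇒≡∨≡+n : ∀ {s t} → s ≈ t → s < n + n → t < n → s ≡ t ⊎ s ≡ t + n
  ≈∧<2n⇒≡∨≡+n {s} {t} s≈t s<2n t<n with <-cmp s t
  ... | tri≈ _ s≡t _ = inj₁ s≡t
  ... | tri< s<t _ _ =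
    contradiction (≤-trans (m≤n+m n s) (≈∧<⇒+n≤ s≈t s<t)) (<⇒≱ t<n)
  ... | tri> _ _ t<s with m≤n⇒m<n∨m≡n (≈∧<⇒+n≤ (≈-sym s≈t) t<s)
  ...   | inj₂ t+n≡s = inj₂ (sym t+n≡s)
  ...   | inj₁ t+n<s = contradiction
    (≤-trans (+-monoˡ-≤ n (m≤n+m n t)) (≈∧<⇒+n≤ (≈-trans (+n-≈ t) (≈-sym s≈t)) t+n<s))
    (<⇒≱ s<2n)

  abstract
    pt : ℕ → Fin n
    pt a = fromℕ< (m%n<n a n)

    toℕ-pt : ∀ a → toℕ (pt a) ≈ a
    toℕ-pt a = ≈-trans (≈-reflexive (toℕ-fromℕ< (m%n<n a n))) (%-≈ a)

  toℕ-injective-≈ : {u v : Fin n} → toℕ u ≈ toℕ v → u ≡ v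
  toℕ-injective-≈ {u} {v} u≈v = toℕ-injective (≈∧<⇒≡ u≈v (toℕ<n u) (toℕ<n v))

  pt-≡ : ∀ {a u} → a ≈ toℕ u → pt a ≡ u
  pt-≡ {a} a≈u = toℕ-injective-≈ (≈-trans (toℕ-pt a) a≈u)

  abstract
    -- The number of steps from u to v in the direction of increasing labels.
    off : Fin n → Fin n → ℕ
    off u v = (toℕ v + (n ∸ toℕ u)) % n

    off<n : ∀ u v → off u v < n
    off<n u v = m%n<n (toℕ v + (n ∸ toℕ u)) n

    off-≈ : ∀ u v → toℕ u + off u v ≈ toℕ v
    off-≈ u v = ≈-trans (+-cong-≈ (≈-refl {toℕ u}) (%-≈ _))
      (≈-trans (≈-reflexive (rearrange (toℕ u) (toℕ v) (<⇒≤ (toℕ<n u)))) (+n-≈ (toℕ v)))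
      where
      rearrange : ∀ a b → a ≤ n → a + (b + (n ∸ a)) ≡ b + n
      rearrange a b a≤n = trans (sym (+-assoc a b _)) (trans (cong (_+ (n ∸ a)) (+-comm a b))
        (trans (+-assoc b a _) (cong (b +_) (m+[n∸m]≡n a≤n))))

  ≈⇒off≡ : ∀ {u v i} → toℕ u + i ≈ toℕ v → i < n → off u v ≡ i
  ≈⇒off≡ {u} {v} u+i≈v i<n = ≈∧<⇒≡
    (+-cancelˡ-≈ (toℕ u) (≈-trans (off-≈ u v) (≈-sym u+i≈v))) (off<n u v) i<n

  ≈⇒off≤ : ∀ {u v} i → toℕ u + i ≈ toℕ v → off u v ≤ i
  ≈⇒off≤ {u} {v} i u+i≈v = ≤-trans
    (≤-reflexive (trans (sym (m<n⇒m%n≡m (off<n u v)))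
      (≈⇒%≡ (+-cancelˡ-≈ (toℕ u) (≈-trans (off-≈ u v) (≈-sym u+i≈v))))))
    (m%n≤m i n)

  off-self : ∀ u → off u u ≡ 0
  off-self u = n≤0⇒n≡0 (≈⇒off≤ 0 (≈-reflexive (+-identityʳ (toℕ u))))

  off-injective : ∀ u {v w} → off u v ≡ off u w → v ≡ w
  off-injective u {v} {w} eq = toℕ-injective-≈
    (≈-trans (≈-sym (off-≈ u v)) (≈-trans (≈-reflexive (cong (toℕ u +_) eq)) (off-≈ u w)))

  off≡0⇒≡ : ∀ u v → off u v ≡ 0 → v ≡ u
  off≡0⇒≡ u v eq = off-injective u (trans eq (sym (off-self u)))

  abstract
    -- Both sides agree modulo `n` and the left one is below `n + n`, so the detour via `v` costs at
    -- most one extra turn.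
    off-+ : ∀ u v w → off u v + off v w ≡ off u w ⊎ off u v + off v w ≡ off u w + n
    off-+ u v w = ≈∧<2n⇒≡∨≡+n
      (+-cancelˡ-≈ (toℕ u) (≈-trans (≈-reflexive (sym (+-assoc (toℕ u) _ _)))
        (≈-trans (+-cong-≈ (off-≈ u v) ≈-refl) (≈-trans (off-≈ v w) (≈-sym (off-≈ u w))))))
      (+-mono-< (off<n u v) (off<n v w)) (off<n u w)

  off-round : ∀ u v → off u v + off v u ≤ n
  off-round u v = [ (λ eq → ≤-trans (≤-reflexive (trans eq (off-self u))) z≤n)
                  , (λ eq → ≤-reflexive (trans eq (cong (_+ n) (off-self u)))) ]′
                  (off-+ u v u)

  -- The start `e` is a natural number read modulo `n`, so that adding `n ∸ 1` moves it back by one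
  -- step.
  InArc : ℕ → ℕ → Fin n → Set
  InArc e ℓ x = ∃[ i ] i ≤ ℓ × e + i ≈ toℕ x

  off≤⇒InArc : ∀ {u v ℓ} → off u v ≤ ℓ → InArc (toℕ u) ℓ v
  off≤⇒InArc {u} {v} ≤ℓ = off u v , ≤ℓ , off-≈ u v

  -- The arc is a union of `suc ℓ` singletons, which may coincide when it wraps around.
  ∣arc∣≤ : ∀ e ℓ (S : Subset n) → (∀ {x} → x ∈ S → InArc e ℓ x) → ∣ S ∣ ≤ suc ℓ
  ∣arc∣≤ e ℓ S S⊆arc = ≤-trans (p⊆q⇒∣p∣≤∣q∣ (λ x∈S → InArc⇒∈ ℓ (S⊆arc x∈S))) (∣arc∣ ℓ)
    where
    arc : ℕ → Subset n
    arc zero    = ⁅ pt (e + 0) ⁆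
    arc (suc ℓ) = ⁅ pt (e + suc ℓ) ⁆ ∪ arc ℓ

    ∣arc∣ : ∀ ℓ → ∣ arc ℓ ∣ ≤ suc ℓ
    ∣arc∣ zero    = ≤-reflexive (∣⁅x⁆∣≡1 (pt (e + 0)))
    ∣arc∣ (suc ℓ) = ≤-trans (∣⁅x⁆∪p∣≤1+∣p∣ (pt (e + suc ℓ)) (arc ℓ)) (s≤s (∣arc∣ ℓ))

    InArc⇒∈ : ∀ {x} ℓ → InArc e ℓ x → x ∈ arc ℓ
    InArc⇒∈ zero    (.0 , z≤n , eq) with refl ← pt-≡ eq = x∈⁅x⁆ _
    InArc⇒∈ (suc ℓ) (i , i≤ , eq) with m≤n⇒m<n∨m≡n i≤
    ... | inj₁ (s≤s i≤ℓ) = ∈-⁅⁆∪ (inj₂ (InArc⇒∈ ℓ (i , i≤ℓ , eq)))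
    ... | inj₂ refl      = ∈-⁅⁆∪ (inj₁ (sym (pt-≡ eq)))

  -- Since `v` precedes `u` on the arc, going clockwise from `u` to `v` means going round:
  -- `j + n ≤ i + off u v`.
  wrap : ∀ {e i j u v m} → e + i ≈ toℕ u → e + j ≈ toℕ v → j < i → i ≤ m → n ≤ off u v + m
  wrap {e} {i} {j} {u} {v} {m} e+i≈u e+j≈v j<i i≤m = ≤-trans (m≤n+m n j) (≤-trans
    (≈∧<⇒+n≤ (≈-sym i+off≈j) (≤-trans j<i (m≤m+n i _)))
    (≤-trans (+-monoˡ-≤ (off u v) i≤m) (≤-reflexive (+-comm m _))))
    where
    i+off≈j : i + off u v ≈ j
    i+off≈j = +-cancelˡ-≈ e (≈-trans (≈-reflexive (sym (+-assoc e i _)))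
      (≈-trans (+-cong-≈ e+i≈u ≈-refl) (≈-trans (off-≈ u v) (≈-sym e+j≈v))))

  -- Around the cycle `p → q → r → p` some step decreases the position on the arc, and `wrap`
  -- applies to it; otherwise all positions are equal, which `p ≢ r` excludes.
  wideGap : ∀ {e m p q r} → p ≢ r → InArc e m p → InArc e m q → InArc e m r →
    n ≤ off p q + m ⊎ n ≤ off q r + m ⊎ n ≤ off r p + m
  wideGap p≢r (i , i≤m , ei) (j , j≤m , ej) (k , k≤m , ek) with <-≤-connex j i | <-≤-connex k j
  ... | inj₁ j<i | _        = inj₁ (wrap ei ej j<i i≤m)
  ... | inj₂ _   | inj₁ k<j = inj₂ (inj₁ (wrap ej ek k<j j≤m))
  ... | inj₂ i≤j | inj₂ j≤k with m≤n⇒m<n∨m≡n (≤-trans i≤j j≤k)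
  ...   | inj₁ i<k  = inj₂ (inj₂ (wrap ek ei i<k k≤m))
  ...   | inj₂ refl = contradiction (toℕ-injective-≈ (≈-trans (≈-sym ei) ek)) p≢r

  complement≤ : ∀ {u v m} → n ≤ off u v + m → off v u ≤ m
  complement≤ {u} {v} n≤ = +-cancelˡ-≤ (off u v) _ _ (≤-trans (off-round u v) n≤)

  -- Sets whose triples all lie on arcs of length `m`.

  module ThreeInArc (S : Subset n) (m : ℕ) (2m≤n : m + m ≤ n)
    (arcs : ∀ {p q r} → p ∈ S → q ∈ S → r ∈ S →
            ∃[ e ] InArc e m p × InArc e m q × InArc e m r) where

    Covered : Set
    Covered = ∃[ b ] (∀ {x} → x ∈ S → off b x ≤ m)

    abstract
      gap : ∀ {p q r} → p ∈ S → q ∈ S → r ∈ S → p ≢ r →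
        n ≤ off p q + m ⊎ n ≤ off q r + m ⊎ n ≤ off r p + m
      gap p∈S q∈S r∈S p≢r with _ , p , q , r ← arcs p∈S q∈S r∈S = wideGap p≢r p q r

    far⇒≢ : ∀ {u v} → m < off u v → u ≢ v
    far⇒≢ {u} m<uv refl = m<n⇒n≢0 m<uv (off-self u)

    abstract
      far? : ∀ b → (∃[ x ] x ∈ S × m < off b x) ⊎ (∀ {x} → x ∈ S → off b x ≤ m)
      far? b with any? (λ x → x ∈? S ×-dec m <? off b x)
      ... | yes far = inj₁ far
      ... | no ¬far = inj₂ (λ {x} x∈S → ≮⇒≥ (λ m<bx → ¬far (x , x∈S , m<bx)))

    -- Maximises `off b c` among offsets at most `m`: each round stops or passes to a pair `(x , c)`
    -- of larger offset. The bound `m` on offsets makes `gas` sufficient.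
    search : ∀ gas {b c} → b ∈ S → c ∈ S → off b c ≤ m → m ≤ off b c + gas →
      Covered ⊎ (m + m ≡ n × ∃[ b ] ∃[ c ] b ∈ S × c ∈ S × off b c ≡ m)
    search gas {b} {c} b∈S c∈S bc≤m m≤bc+gas with far? b
    ... | inj₂ covered = inj₁ (b , covered)
    ... | inj₁ (x , x∈S , m<bx) with gap b∈S c∈S x∈S (far⇒≢ m<bx)
    -- Here `n ≤ off b c + m ≤ m + m ≤ n`, so equality holds throughout.
    ...   | inj₁ n≤bc+m = inj₂
      ( ≤-antisym 2m≤n (≤-trans n≤bc+m (+-monoˡ-≤ m bc≤m)) , b , c , b∈S , c∈S
      , ≤-antisym bc≤m (+-cancelʳ-≤ m _ _ (≤-trans 2m≤n n≤bc+m)) )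
    ...   | inj₂ (inj₂ n≤xb+m) = contradiction (complement≤ {x} n≤xb+m) (<⇒≱ m<bx)
    ...   | inj₂ (inj₁ n≤cx+m) = continue gas m≤bc+gas
      where
      xc≤m : off x c ≤ m
      xc≤m = complement≤ {c} n≤cx+m

      -- The way from `x` to `c` passes `b`, which differs from `x`; if `off x b + off b c` made a
      -- full turn, then `off b x ≤ off b c ≤ m`.
      bc<xc : off b c < off x c
      bc<xc with off-+ x b c
      ... | inj₁ eq = ≤-trans (+-monoˡ-≤ (off b c) (n≢0⇒n>0 (far⇒≢ m<bx ∘ off≡0⇒≡ x b)))
        (≤-reflexive eq)
      ... | inj₂ eq = contradiction
        (+-cancelˡ-≤ (off x b) _ _ (≤-trans (off-round x b)
          (≤-trans (m≤n+m n (off x c)) (≤-reflexive (sym eq)))))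
        (<⇒≱ (≤-<-trans bc≤m m<bx))

      continue : ∀ gas → m ≤ off b c + gas →
        Covered ⊎ (m + m ≡ n × ∃[ b ] ∃[ c ] b ∈ S × c ∈ S × off b c ≡ m)
      -- Out of gas: `m ≤ off b c < off x c ≤ m`.
      continue zero      m≤ = contradiction xc≤m
        (<⇒≱ (≤-<-trans (≤-trans m≤ (≤-reflexive (+-identityʳ _))) bc<xc))
      continue (suc gas) m≤ = search gas x∈S c∈S xc≤m
        (≤-trans m≤ (≤-trans (≤-reflexive (+-suc _ gas)) (+-monoˡ-≤ gas bc<xc)))

    -- The case of an antipodal pair.

    module Antipodal (2m≡n : m + m ≡ n) where

      half≤ : ∀ {a} → n ≤ a + m → m ≤ a
      half≤ n≤a+m = +-cancelʳ-≤ m _ _ (≤-trans 2m≤n n≤a+m)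

      half-sym : ∀ {u v} → off u v ≡ m → off v u ≡ m
      half-sym {u} {v} uv≡m with off-+ u v u
      -- Without a full turn both offsets are zero, and `m` with them.
      ... | inj₁ eq = trans (m+n≡0⇒n≡0 (off u v) eq₀) (trans (sym (m+n≡0⇒m≡0 _ eq₀)) uv≡m)
        where eq₀ = trans eq (off-self u)
      ... | inj₂ eq = +-cancelˡ-≡ m _ _ (trans (cong (_+ off v u) (sym uv≡m))
        (trans eq (trans (cong (_+ n) (off-self u)) (sym 2m≡n))))

      -- From `u` one meets `v` after half a turn and `w` later, so `w` follows `v` within the
      -- remaining half.
      pastHalf : ∀ {u v w} → off u v ≡ m → m < off u w → off v w < m
      pastHalf {u} {v} {w} uv≡m m<uw with off-+ u v w
      ... | inj₁ eq = +-cancelˡ-< m _ _ (subst₂ _<_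
        (trans (sym eq) (cong (_+ off v w) uv≡m)) (sym 2m≡n) (off<n u w))
      ... | inj₂ eq = contradiction (trans (cong (_+ off v w) (sym uv≡m)) eq)
        (<⇒≢ (+-mono-< m<uw (off<n v w)))

      -- `x` and `y` lie on different sides of the diameter from `b` to `c`. Among `b`, `y`, `x`
      -- only the gap from `y` to `x` can be wide, among `c`, `x`, `y` only the gap from `x` to `y`.
      opposite : ∀ {b c x y} → b ∈ S → c ∈ S → x ∈ S → y ∈ S → off b c ≡ m →
        m < off b x → m < off c y → off x y ≡ m
      opposite {b} {c} {x} {y} b∈S c∈S x∈S y∈S bc≡m m<bx m<cy = ≤-antisym xy≤m m≤xy
        where
        xy≤m : off x y ≤ m
        xy≤m with gap b∈S y∈S x∈S (far⇒≢ m<bx)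
        ... | inj₁ n≤by+m        =
          contradiction (half≤ n≤by+m) (<⇒≱ (pastHalf (half-sym bc≡m) m<cy))
        ... | inj₂ (inj₁ n≤yx+m) = complement≤ {y} n≤yx+m
        ... | inj₂ (inj₂ n≤xb+m) = contradiction (complement≤ {x} n≤xb+m) (<⇒≱ m<bx)

        m≤xy : m ≤ off x y
        m≤xy with gap c∈S x∈S y∈S (far⇒≢ m<cy)
        ... | inj₁ n≤cx+m        = contradiction (half≤ n≤cx+m) (<⇒≱ (pastHalf bc≡m m<bx))
        ... | inj₂ (inj₁ n≤xy+m) = half≤ n≤xy+m
        ... | inj₂ (inj₂ n≤yc+m) = contradiction (complement≤ {y} n≤yc+m) (<⇒≱ m<cy)

      -- If both sides of `b` and `c` meet `S`, each does so in one vertex, being antipodal to a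
      -- fixed vertex on the other side.
      antipodal⇒∣S∣≤4 : ∀ {b c} → b ∈ S → c ∈ S → off b c ≡ m → Covered ⊎ ∣ S ∣ ≤ 4
      antipodal⇒∣S∣≤4 {b} {c} b∈S c∈S bc≡m with far? b | far? c
      ... | inj₂ covered          | _                     = inj₁ (b , covered)
      ... | inj₁ _                | inj₂ covered          = inj₁ (c , covered)
      ... | inj₁ (x , x∈S , m<bx) | inj₁ (y , y∈S , m<cy) = inj₂
        (≤-trans (p⊆q⇒∣p∣≤∣q∣ S⊆) (≤-trans (∣⁅x⁆∪p∣≤1+∣p∣ b (⁅ c ⁆ ∪ (⁅ x ⁆ ∪ ⁅ y ⁆))) (s≤s
          (≤-trans (∣⁅x⁆∪p∣≤1+∣p∣ c (⁅ x ⁆ ∪ ⁅ y ⁆)) (s≤s (≤-trans (∣⁅x⁆∪p∣≤1+∣p∣ x ⁅ y ⁆) (s≤s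
            (≤-reflexive (∣⁅x⁆∣≡1 y)))))))))
        where
        opposite′ : ∀ {x y} → x ∈ S → y ∈ S → m < off b x → m < off c y → off x y ≡ m
        opposite′ x∈S y∈S = opposite b∈S c∈S x∈S y∈S bc≡m

        S⊆ : S ⊆ ⁅ b ⁆ ∪ (⁅ c ⁆ ∪ (⁅ x ⁆ ∪ ⁅ y ⁆))
        S⊆ {z} z∈S with <-≤-connex m (off b z) | <-≤-connex m (off c z)
        ... | inj₁ m<bz | _ = ∈-⁅⁆∪ (inj₂ (∈-⁅⁆∪ (inj₂ (∈-⁅⁆∪ (inj₁ (off-injective y
          (trans (half-sym (opposite′ z∈S y∈S m<bz m<cy))
            (sym (half-sym (opposite′ x∈S y∈S m<bx m<cy))))))))))
        ... | inj₂ _ | inj₁ m<cz = ∈-⁅⁆∪ (inj₂ (∈-⁅⁆∪ (inj₂ (∈-⁅⁆∪ (inj₂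
          (subst (_∈ ⁅ y ⁆) (sym z≡y) (x∈⁅x⁆ y)))))))
          where
          z≡y : z ≡ y
          z≡y = off-injective x
            (trans (opposite′ x∈S z∈S m<bx m<cz) (sym (opposite′ x∈S y∈S m<bx m<cy)))
        -- On neither side: `m + off c z` is `off b z`, forcing `z ≡ c`, or `off b z + n`, forcing
        -- `z ≡ b`.
        ... | inj₂ bz≤m | inj₂ cz≤m with off-+ b c z
        ...   | inj₁ eq = ∈-⁅⁆∪ (inj₂ (∈-⁅⁆∪ (inj₁ (off≡0⇒≡ c z (n≤0⇒n≡0 (+-cancelˡ-≤ m _ _
          (≤-trans (≤-reflexive (trans (cong (_+ off c z) (sym bc≡m)) eq))
            (≤-trans bz≤m (≤-reflexive (sym (+-identityʳ m)))))))))))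
        ...   | inj₂ eq = ∈-⁅⁆∪ (inj₁ (off≡0⇒≡ b z (n≤0⇒n≡0 (+-cancelʳ-≤ n _ _
          (≤-trans (≤-reflexive (trans (sym eq) (cong (_+ off c z) bc≡m)))
            (≤-trans (+-monoʳ-≤ m cz≤m) (≤-reflexive 2m≡n)))))))

    covered⇒∣S∣≤ : Covered → ∣ S ∣ ≤ suc m
    covered⇒∣S∣≤ (b , covered) = ∣arc∣≤ (toℕ b) m S (off≤⇒InArc ∘ covered)

    -- The hypothesis makes the bound 4 of the antipodal case at most `suc m`.
    ∣S∣≤ : (m + m ≡ n → 3 ≤ m) → ∣ S ∣ ≤ suc m
    ∣S∣≤ 2m≡n⇒3≤m with nonempty? S
    ... | no empty = ≤-trans (≤-reflexive (trans (cong ∣_∣ (Empty-unique empty)) (∣⊥∣≡0 n))) z≤n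
    ... | yes (b , b∈S)
      -- Starting from the pair `(b , b)` of offset 0, `m` units of gas suffice.
      with search m b∈S b∈S (≤-trans (≤-reflexive (off-self b)) z≤n) (m≤n+m m (off b b))
    ...   | inj₁ covered = covered⇒∣S∣≤ covered
    ...   | inj₂ (2m≡n , _ , _ , p , q , eq) with Antipodal.antipodal⇒∣S∣≤4 2m≡n p q eq
    ...     | inj₁ covered = covered⇒∣S∣≤ covered
    ...     | inj₂ ∣S∣≤4   = ≤-trans ∣S∣≤4 (s≤s (2m≡n⇒3≤m 2m≡n))

-- Walks along a sequence of vertices, and cliques, in arbitrary graphs.

module _ {n} (G : Graph n) where

  open import Data.List using (_∷_)
  open Graph G

  -- Indices run downwards, so that recursion on `j` strips the first edge and the vertices form an
  -- `applyDownFrom`.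
  walkAlong : (f : ℕ → Fin n) → ∀ j → (∀ {i} → i < j → Adj (f (suc i)) (f i)) →
    Walk G (f j) (f 0)
  walkAlong f zero    adj = ε
  walkAlong f (suc j) adj = adj ≤-refl ◅ walkAlong f j (λ i<j → adj (m<n⇒m<1+n i<j))

  length-walkAlong : ∀ f j (adj : ∀ {i} → i < j → Adj (f (suc i)) (f i)) →
    length G (walkAlong f j adj) ≡ j
  length-walkAlong f zero    adj = refl
  length-walkAlong f (suc j) adj = cong suc (length-walkAlong f j _)

  vertices-walkAlong : ∀ f j (adj : ∀ {i} → i < j → Adj (f (suc i)) (f i)) →
    vertices G (walkAlong f j adj) ≡ applyDownFrom f (suc j)
  vertices-walkAlong f zero    adj = refl
  vertices-walkAlong f (suc j) adj = cong (f (suc j) ∷_) (vertices-walkAlong f j _)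

  pathAlong : ∀ {u v} (f : ℕ → Fin n) j → f j ≡ u → f 0 ≡ v →
    (∀ {i} → i < j → Adj (f (suc i)) (f i)) →
    (∀ {i i′} → i ≤ j → i′ ≤ j → f i ≡ f i′ → i ≡ i′) →
    ∃[ w ] IsPath G {u} {v} w × length G w ≡ j × (∀ {i} → i ≤ j → f i List.∈ vertices G w)
  pathAlong f j refl refl adj injective = walkAlong f j adj , path , length-walkAlong f j adj , covers
    where
    path : Unique (vertices G (walkAlong f j adj))
    path = subst Unique (sym (vertices-walkAlong f j adj)) (applyDownFrom⁺₁ f (suc j)
      λ { i′<i (s≤s i≤j) eq → <⇒≢ i′<i (sym (injective i≤j (≤-trans (<⇒≤ i′<i) i≤j) eq)) })

    covers : ∀ {i} → i ≤ j → f i List.∈ vertices G (walkAlong f j adj)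
    covers i≤j = subst (f _ List.∈_) (sym (vertices-walkAlong f j adj)) (∈-applyDownFrom⁺ f (s≤s i≤j))

  source∈vertices : ∀ {u v} (w : Walk G u v) → u List.∈ vertices G w
  source∈vertices ε       = here refl
  source∈vertices (_ ◅ _) = here refl

  target∈vertices : ∀ {u v} (w : Walk G u v) → v List.∈ vertices G w
  target∈vertices ε       = here refl
  target∈vertices (_ ◅ w) = there (target∈vertices w)

  InShortestPath : ℕ → Subset n → Set
  InShortestPath d T = ∃[ u ] ∃[ v ] Σ (Walk G u v) λ w →
    IsShortestPath G w × length G w ≤ d × (∀ {x} → x ∈ T → x List.∈ vertices G w)

  small⇒IsClique : ∀ {k d} (S : Subset n) → ∣ S ∣ < k → IsClique G k d S
  small⇒IsClique S ∣S∣<k T T⊆S ∣T∣≡k =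
    contradiction (≤-trans (≤-reflexive (sym ∣T∣≡k)) (p⊆q⇒∣p∣≤∣q∣ T⊆S)) (<⇒≱ ∣S∣<k)

  maximumClique⇒IsOmega : ∀ {k d m} (S : Subset n) → IsClique G k d S → ∣ S ∣ ≡ m →
    (∀ S → IsClique G k d S → ∣ S ∣ ≤ m) → IsOmega k d G m
  maximumClique⇒IsOmega S clique ∣S∣≡m bound =
    (λ { (S′ , clique′ , refl) → bound S′ clique′ }) , (λ _ upper → upper (S , clique , ∣S∣≡m))

-- Halving.

⌊n/2⌋+⌊n/2⌋≤n : ∀ n → ⌊ n /2⌋ + ⌊ n /2⌋ ≤ n
⌊n/2⌋+⌊n/2⌋≤n n =
  ≤-trans (+-monoʳ-≤ ⌊ n /2⌋ (⌊n/2⌋≤⌈n/2⌉ n)) (≤-reflexive (⌊n/2⌋+⌈n/2⌉≡n n))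

n≤⌊n/2⌋+1+⌊n/2⌋ : ∀ n → n ≤ ⌊ n /2⌋ + suc ⌊ n /2⌋
n≤⌊n/2⌋+1+⌊n/2⌋ n = ≤-trans (≤-reflexive (sym (⌊n/2⌋+⌈n/2⌉≡n n)))
  (+-monoʳ-≤ ⌊ n /2⌋ (⌊n/2⌋-mono (n≤1+n (suc n))))

0<n⇒⌊n/2⌋<n : ∀ {n} → 0 < n → ⌊ n /2⌋ < n
0<n⇒⌊n/2⌋<n (s≤s {n = n} _) = ⌊n/2⌋<n n

m+m≤n⇒m≤⌊n/2⌋ : ∀ {m n} → m + m ≤ n → m ≤ ⌊ n /2⌋
m+m≤n⇒m≤⌊n/2⌋ {m} m+m≤n = ≤-trans (≤-reflexive (n≡⌊n+n/2⌋ m)) (⌊n/2⌋-mono m+m≤n)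

m+m≤n+n⇒m≤n : ∀ {m n} → m + m ≤ n + n → m ≤ n
m+m≤n+n⇒m≤n {n = n} m+m≤n+n =
  ≤-trans (m+m≤n⇒m≤⌊n/2⌋ m+m≤n+n) (≤-reflexive (sym (n≡⌊n+n/2⌋ n)))

-- Paths, arcs and distances in the cycle.

module CycleGraph (n : ℕ) (n≥3 : n ≥ 3) where

  instance
    n≢0 : NonZero n
    n≢0 = >-nonZero (≤-trans (s≤s z≤n) n≥3)

  open Cyclic n

  C : Graph n
  C = cycle n n≥3

  0<n : 0 < n
  0<n = ≤-trans (s≤s z≤n) n≥3

  suc-cong-≈ : ∀ {a b} → a ≈ b → suc a ≈ suc b
  suc-cong-≈ = +-cong-≈ (≈-refl {1})

  -- Together with `≈⇒Next` this makes `Next` the successor modulo `n`, without a case split at the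
  -- last vertex.
  Next⇒≈ : {i j : Fin n} → Next i j → toℕ j ≈ suc (toℕ i)
  Next⇒≈ (inj₁ j≡1+i)         = ≈-reflexive j≡1+i
  Next⇒≈ (inj₂ (1+i≡n , j≡0)) = ≈-sym (≈-trans (≈-reflexive 1+i≡n)
    (≈-trans (+n-≈ 0) (≈-reflexive (sym j≡0))))

  ≈⇒Next : {i j : Fin n} → toℕ j ≈ suc (toℕ i) → Next i j
  ≈⇒Next {i} {j} j≈1+i with m≤n⇒m<n∨m≡n (toℕ<n i)
  ... | inj₁ 1+i<n = inj₁ (≈∧<⇒≡ j≈1+i (toℕ<n j) 1+i<n)
  ... | inj₂ 1+i≡n = inj₂ (1+i≡n , ≈∧<⇒≡
    (≈-trans j≈1+i (≈-trans (≈-reflexive 1+i≡n) (+n-≈ 0))) (toℕ<n j) 0<n)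

  pt-Next : ∀ a → Next (pt a) (pt (suc a))
  pt-Next a = ≈⇒Next (≈-trans (toℕ-pt (suc a)) (suc-cong-≈ (≈-sym (toℕ-pt a))))

  pt-injective : ∀ a {i j} → i < n → j < n → pt (a + i) ≡ pt (a + j) → i ≡ j
  pt-injective a {i} {j} i<n j<n eq = ≈∧<⇒≡ (+-cancelˡ-≈ a (≈-trans (≈-sym (toℕ-pt (a + i)))
    (≈-trans (≈-reflexive (cong toℕ eq)) (toℕ-pt (a + j))))) i<n j<n

  abstract
    increasingPath : ∀ u v → ∃[ w ] IsPath C {u} {v} w × length C w ≡ off u v
    increasingPath u v =
      let w , path , length≡ , _ = pathAlong C f (off u v) f-start f-end adj injective in
      w , path , length≡
      where
      f : ℕ → Fin n
      -- `pathAlong` reads `f` from the top index down, so `f i` is `i` steps before `v`.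
      f i = pt (toℕ u + (off u v ∸ i))

      f-start : f (off u v) ≡ u
      f-start = pt-≡ (≈-reflexive (trans (cong (toℕ u +_) (n∸n≡0 (off u v))) (+-identityʳ _)))

      f-end : f 0 ≡ v
      f-end = pt-≡ (off-≈ u v)

      adj : ∀ {i} → i < off u v → Graph.Adj C (f (suc i)) (f i)
      adj {i} i<off = inj₁ (subst (Next (f (suc i))) (cong pt 1+f≡) (pt-Next _))
        where
        1+f≡ : suc (toℕ u + (off u v ∸ suc i)) ≡ toℕ u + (off u v ∸ i)
        1+f≡ = trans (sym (+-suc (toℕ u) _)) (cong (toℕ u +_) (sym (+-∸-assoc 1 i<off)))

      injective : ∀ {i j} → i ≤ off u v → j ≤ off u v → f i ≡ f j → i ≡ j
      injective {i} {j} i≤ j≤ eq = ∸-cancelˡ-≡ i≤ j≤ (pt-injective (toℕ u)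
        (≤-<-trans (m∸n≤m (off u v) i) (off<n u v)) (≤-<-trans (m∸n≤m (off u v) j) (off<n u v)) eq)

    decreasingPath : ∀ u v → ∃[ w ] IsPath C {v} {u} w × length C w ≡ off u v ×
      (∀ {i} → i ≤ off u v → pt (toℕ u + i) List.∈ vertices C w)
    decreasingPath u v = pathAlong C f (off u v) (pt-≡ (off-≈ u v))
      (pt-≡ (≈-reflexive (+-identityʳ _)))
      (λ {i} _ → inj₂ (subst (Next (f i)) (cong pt (sym (+-suc (toℕ u) i))) (pt-Next _)))
      (λ i≤ j≤ → pt-injective (toℕ u) (≤-<-trans i≤ (off<n u v)) (≤-<-trans j≤ (off<n u v)))
      where
      f : ℕ → Fin n
      f i = pt (toℕ u + i)

    -- By induction: the new first vertex is adjacent to one on the arc, so extending the arc by one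
    -- step at one end suffices.
    walk⊆arc : ∀ {u v} (w : Walk C u v) →
      ∃[ e ] (∀ {x} → x List.∈ vertices C w → InArc e (length C w) x)
    walk⊆arc {u} ε = toℕ u , λ { (here refl) → 0 , z≤n , ≈-reflexive (+-identityʳ _) }
    walk⊆arc {u} (u~u′ ◅ w) with walk⊆arc w
    walk⊆arc {u} (inj₂ next ◅ w) | e , w⊆arc with w⊆arc (source∈vertices C w)
    ... | i , i≤ℓ , e+i≈u′ = e , λ
      { (here refl) → suc i , s≤s i≤ℓ , ≈-trans (≈-reflexive (+-suc e i))
                        (≈-trans (suc-cong-≈ e+i≈u′) (≈-sym (Next⇒≈ next)))
      ; (there x∈w) → let j , j≤ℓ , e+j≈x = w⊆arc x∈w in j , m≤n⇒m≤1+n j≤ℓ , e+j≈x }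
    walk⊆arc {u} (inj₁ next ◅ w) | e , w⊆arc with w⊆arc (source∈vertices C w)
    -- The start moves one step back: old positions grow by one, and `u`, just before `u′`, gets
    -- position `i`.
    ... | i , i≤ℓ , e+i≈u′ = e + (n ∸ 1) , λ
      { (here refl) → i , m≤n⇒m≤1+n i≤ℓ , +-cancelˡ-≈ 1 (≈-trans
                        (≈-reflexive (sym (+-suc (e + (n ∸ 1)) i)))
                        (≈-trans (shift i) (≈-trans e+i≈u′ (Next⇒≈ next))))
      ; (there x∈w) → let j , j≤ℓ , e+j≈x = w⊆arc x∈w in
                      suc j , s≤s j≤ℓ , ≈-trans (shift j) e+j≈x }
      where
      shift : ∀ j → e + (n ∸ 1) + suc j ≈ e + j
      shift j = ≈-trans (≈-reflexive (trans (+-assoc e (n ∸ 1) (suc j))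
        (trans (cong (e +_) (trans (+-comm (n ∸ 1) (suc j)) (trans (sym (+-suc j (n ∸ 1)))
          (cong (j +_) (m+[n∸m]≡n 0<n))))) (sym (+-assoc e j n))))) (+n-≈ (e + j))

  InArc⇒off≤ : ∀ {e ℓ u v} → InArc e ℓ u → InArc e ℓ v → off u v ≤ ℓ ⊎ off v u ≤ ℓ
  InArc⇒off≤ (i , i≤ℓ , e+i≈u) (j , j≤ℓ , e+j≈v) with ≤-total i j
  ... | inj₁ i≤j = inj₁ (≤-trans (≈⇒off≤ (j ∸ i) (≈-∸ e+i≈u e+j≈v i≤j)) (≤-trans (m∸n≤m j i) j≤ℓ))
  ... | inj₂ j≤i = inj₂ (≤-trans (≈⇒off≤ (i ∸ j) (≈-∸ e+j≈v e+i≈u j≤i)) (≤-trans (m∸n≤m i j) i≤ℓ))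

  -- Unless both are zero, the two offsets add up to `n`.
  off≤off : ∀ u v → off u v + off u v ≤ n → off u v ≤ off v u
  off≤off u v 2uv≤n with off-+ u v u
  ... | inj₁ eq = ≤-trans (≤-reflexive (m+n≡0⇒m≡0 (off u v) (trans eq (off-self u)))) z≤n
  ... | inj₂ eq = +-cancelˡ-≤ (off u v) _ _
    (≤-trans 2uv≤n (≤-reflexive (sym (trans eq (cong (_+ n) (off-self u))))))

  -- Both ends lie on an arc as long as the walk, which bounds one of the two offsets, and `off u v`
  -- is the smaller one.
  off≤length : ∀ {u v} → off u v + off u v ≤ n → (w : Walk C v u) → off u v ≤ length C w
  off≤length {u} {v} 2uv≤n w with e , w⊆arc ← walk⊆arc w =
    [ (λ uv≤ℓ → uv≤ℓ) , ≤-trans (off≤off u v 2uv≤n) ]′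
    (InArc⇒off≤ (w⊆arc (target∈vertices C w)) (w⊆arc (source∈vertices C w)))

  -- Of the two ways round, whose lengths sum to at most `n`, one has length at most `⌊ n /2⌋`.
  shortest⇒length≤ : ∀ {u v} (w : Walk C u v) → IsShortestPath C w → length C w ≤ ⌊ n /2⌋
  shortest⇒length≤ {u} {v} w (_ , _ , minimal) with ≤-<-connex (off u v) ⌊ n /2⌋
  ... | inj₁ uv≤ with w′ , path , length≡ ← increasingPath u v =
    ≤-trans (minimal w′ path) (≤-trans (≤-reflexive length≡) uv≤)
  ... | inj₂ uv> with w′ , path , length≡ , _ ← decreasingPath v u =
    ≤-trans (minimal w′ path) (≤-trans (≤-reflexive length≡) (+-cancelˡ-≤ (suc ⌊ n /2⌋) _ _
      (≤-trans (+-monoˡ-≤ (off v u) uv>) (≤-trans (off-round u v)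
        (≤-trans (n≤⌊n/2⌋+1+⌊n/2⌋ n) (≤-reflexive (+-suc ⌊ n /2⌋ ⌊ n /2⌋)))))))

  -- The arc itself, walked from `b + m` down to `b`, is a shortest path because it covers at most
  -- half of the cycle.
  arc⇒InShortestPath : ∀ {d m} b (T : Subset n) → m ≤ ⌊ n /2⌋ → m ≤ d →
    (∀ {x} → x ∈ T → InArc b m x) → InShortestPath C d T
  arc⇒InShortestPath {d} {m} b T m≤⌊n/2⌋ m≤d T⊆arc
    with w , path , length≡ , covers ← decreasingPath (pt b) (pt (b + m)) =
    pt (b + m) , pt b , w ,
    (path , (w , path , refl) , λ w′ _ → ≤-trans (≤-reflexive length≡) (off≤length 2off≤n w′)) ,
    ≤-trans (≤-reflexive length≡m) m≤d ,
    λ x∈T → let i , i≤m , b+i≈x = T⊆arc x∈T in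
      subst (List._∈ vertices C w) (pt-≡ (≈-trans (+-cong-≈ (toℕ-pt b) ≈-refl) b+i≈x))
        (covers (≤-trans i≤m (≤-reflexive (sym off≡m))))
    where
    m<n : m < n
    m<n = ≤-<-trans m≤⌊n/2⌋ (0<n⇒⌊n/2⌋<n 0<n)

    off≡m : off (pt b) (pt (b + m)) ≡ m
    off≡m = ≈⇒off≡ (≈-trans (+-cong-≈ (toℕ-pt b) ≈-refl) (≈-sym (toℕ-pt (b + m)))) m<n

    length≡m : length C w ≡ m
    length≡m = trans length≡ off≡m

    2off≤n : off (pt b) (pt (b + m)) + off (pt b) (pt (b + m)) ≤ n
    2off≤n = ≤-trans (≤-reflexive (cong₂ _+_ off≡m off≡m))
      (≤-trans (+-mono-≤ m≤⌊n/2⌋ m≤⌊n/2⌋) (⌊n/2⌋+⌊n/2⌋≤n n))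

  abstract
    InShortestPath⇒arc : ∀ {d T} → InShortestPath C d T →
      ∃[ e ] (∀ {x} → x ∈ T → InArc e (⌊ n /2⌋ ⊓ d) x)
    InShortestPath⇒arc (_ , _ , w , shortest , length≤d , T⊆w) with e , w⊆arc ← walk⊆arc w =
      e , λ x∈T → let i , i≤ℓ , e+i≈x = w⊆arc (T⊆w x∈T) in
        i , ≤-trans i≤ℓ (⊓-glb (shortest⇒length≤ w shortest) length≤d) , e+i≈x

  -- Deleting `z` from the cycle leaves an arc of `n ∸ 1` vertices that starts right after `z`.
  InArc-∌ : ∀ {z x} {T : Subset n} → ¬ z ∈ T → x ∈ T → InArc (suc (toℕ z)) (n ∸ 2) x
  InArc-∌ {z} {x} {T} z∉T x∈T = off z x ∸ 1 , ∸-monoˡ-≤ 2 (off<n z x) ,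
    ≈-trans (≈-reflexive (trans (sym (+-suc (toℕ z) _)) (cong (toℕ z +_) (m+[n∸m]≡n 0<zx))))
      (off-≈ z x)
    where
    0<zx : 0 < off z x
    0<zx = n≢0⇒n>0 λ zx≡0 → z∉T (subst (_∈ T) (off≡0⇒≡ z x zx≡0) x∈T)

  -- Clique numbers of the cycle.

  full-omega : ∀ {k d} → n < k → IsOmega k d C n
  full-omega n<k = maximumClique⇒IsOmega C ⊤
    (small⇒IsClique C ⊤ (≤-trans (s≤s (≤-reflexive (∣⊤∣≡n n))) n<k)) (∣⊤∣≡n n) (λ S _ → ∣p∣≤n S)

  -- A `k`-subset would lie on an arc of `⌊ n /2⌋ + 1` vertices, which is too few.
  clique⇒∣S∣<k : ∀ {k d S} → ⌊ n /2⌋ + 1 < k → IsClique C k d S → ∣ S ∣ < k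
  clique⇒∣S∣<k {k} {d} {S} ⌊n/2⌋+1<k clique with <-≤-connex ∣ S ∣ k
  ... | inj₁ ∣S∣<k = ∣S∣<k
  ... | inj₂ k≤∣S∣
    with T , _ , T⊆S , ∣T∣≡k ← interpolate ⊥ S k ⊥⊆ (≤-trans (≤-reflexive (∣⊥∣≡0 n)) z≤n) k≤∣S∣
    with e , T⊆arc ← InShortestPath⇒arc (clique T T⊆S ∣T∣≡k) =
    contradiction
      (≤-trans (≤-reflexive (sym ∣T∣≡k)) (≤-trans (∣arc∣≤ e _ T T⊆arc)
        (≤-trans (s≤s (m⊓n≤m ⌊ n /2⌋ d)) (≤-reflexive (+-comm 1 ⌊ n /2⌋)))))
      (<⇒≱ ⌊n/2⌋+1<k)

  -- Any `k` vertices form a clique vacuously, as the clique parameter is `suc k`.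
  small-omega : ∀ {k d} → suc k ≤ n → ⌊ n /2⌋ + 1 ≤ k → IsOmega (suc k) d C k
  small-omega {k} k<n ⌊n/2⌋+1≤k with S , ∣S∣≡k , _ ← initialSegment k (<⇒≤ k<n) =
    maximumClique⇒IsOmega C S (small⇒IsClique C S (s≤s (≤-reflexive ∣S∣≡k))) ∣S∣≡k
      (λ S clique → s≤s⁻¹ (clique⇒∣S∣<k (s≤s ⌊n/2⌋+1≤k) clique))

  arc-clique : ∀ {k d m} (S : Subset n) → m ≤ ⌊ n /2⌋ → m ≤ d →
    (∀ {x} → x ∈ S → toℕ x < suc m) → IsClique C k d S
  arc-clique S m≤⌊n/2⌋ m≤d S<1+m T T⊆S _ = arc⇒InShortestPath 0 T m≤⌊n/2⌋ m≤d
    λ {x} x∈T → toℕ x , s≤s⁻¹ (S<1+m (T⊆S x∈T)) , ≈-refl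

  clique⇒∣S∣≤ : ∀ {k d S} → 3 ≤ k → k ≤ suc (⌊ n /2⌋ ⊓ d) → ¬ (k ≡ 3 × n ≡ 4) →
    IsClique C k d S → ∣ S ∣ ≤ suc (⌊ n /2⌋ ⊓ d)
  clique⇒∣S∣≤ {k} {d} {S} 3≤k k≤1+m exception clique with ≤-total ∣ S ∣ k
  ... | inj₁ ∣S∣≤k = ≤-trans ∣S∣≤k k≤1+m
  ... | inj₂ k≤∣S∣ = ThreeInArc.∣S∣≤ S m 2m≤n arcs 2m≡n⇒3≤m
    where
    m : ℕ
    m = ⌊ n /2⌋ ⊓ d

    2m≤n : m + m ≤ n
    2m≤n = ≤-trans (+-mono-≤ (m⊓n≤m ⌊ n /2⌋ d) (m⊓n≤m ⌊ n /2⌋ d)) (⌊n/2⌋+⌊n/2⌋≤n n)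

    arcs : ∀ {p q r} → p ∈ S → q ∈ S → r ∈ S →
      ∃[ e ] InArc e m p × InArc e m q × InArc e m r
    arcs {p} {q} {r} p∈S q∈S r∈S
      -- The triple is padded to a `k`-subset of `S`.
      with T , A⊆T , T⊆S , ∣T∣≡k ← interpolate (⁅ p ⁆ ∪ (⁅ q ⁆ ∪ ⁅ r ⁆)) S k
        (⁅⁆∪-⊆ p∈S (⁅⁆∪-⊆ q∈S (λ x∈⁅r⁆ → subst (_∈ S) (sym (x∈⁅y⁆⇒x≡y r x∈⁅r⁆)) r∈S)))
        (≤-trans (∣⁅x⁆∪p∣≤1+∣p∣ p (⁅ q ⁆ ∪ ⁅ r ⁆)) (≤-trans (s≤s (≤-trans (∣⁅x⁆∪p∣≤1+∣p∣ q ⁅ r ⁆)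
          (s≤s (≤-reflexive (∣⁅x⁆∣≡1 r))))) 3≤k))
        k≤∣S∣
      with e , T⊆arc ← InShortestPath⇒arc (clique T T⊆S ∣T∣≡k) =
      e , T⊆arc (A⊆T (∈-⁅⁆∪ (inj₁ refl))) , T⊆arc (A⊆T (∈-⁅⁆∪ (inj₂ (∈-⁅⁆∪ (inj₁ refl))))) ,
      T⊆arc (A⊆T (∈-⁅⁆∪ (inj₂ (∈-⁅⁆∪ (inj₂ (x∈⁅x⁆ r))))))

    -- `3 ≤ k ≤ suc m` gives `2 ≤ m`, and `m ≡ 2` would mean `k ≡ 3` and `n ≡ 4`.
    2m≡n⇒3≤m : m + m ≡ n → 3 ≤ m
    2m≡n⇒3≤m 2m≡n with m≤n⇒m<n∨m≡n (s≤s⁻¹ (≤-trans 3≤k k≤1+m))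
    ... | inj₁ 3≤m = 3≤m
    ... | inj₂ 2≡m = contradiction
      ( ≤-antisym (≤-trans k≤1+m (≤-reflexive (cong suc (sym 2≡m)))) 3≤k
      , trans (sym 2m≡n) (cong₂ _+_ (sym 2≡m) (sym 2≡m)) ) exception

  arc-omega : ∀ {k d} → 3 ≤ k → k ≤ d + 1 → k ≤ ⌊ n /2⌋ + 1 → ¬ (k ≡ 3 × n ≡ 4) →
    IsOmega k d C ((⌊ n /2⌋ + 1) ⊓ (d + 1))
  arc-omega {k} {d} 3≤k k≤d+1 k≤⌊n/2⌋+1 exception =
    let S , ∣S∣≡1+m , S<1+m = initialSegment (suc (⌊ n /2⌋ ⊓ d)) 1+m≤n in
    maximumClique⇒IsOmega C S
      (arc-clique S (m⊓n≤m ⌊ n /2⌋ d) (m⊓n≤n ⌊ n /2⌋ d) S<1+m) (trans ∣S∣≡1+m 1+m≡)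
      (λ S clique → ≤-trans (clique⇒∣S∣≤ 3≤k k≤1+m exception clique) (≤-reflexive 1+m≡))
    where
    1+m≡ : suc (⌊ n /2⌋ ⊓ d) ≡ (⌊ n /2⌋ + 1) ⊓ (d + 1)
    1+m≡ = cong₂ _⊓_ (+-comm 1 ⌊ n /2⌋) (+-comm 1 d)

    k≤1+m : k ≤ suc (⌊ n /2⌋ ⊓ d)
    k≤1+m = ≤-trans (⊓-glb k≤⌊n/2⌋+1 k≤d+1) (≤-reflexive (sym 1+m≡))

    1+m≤n : suc (⌊ n /2⌋ ⊓ d) ≤ n
    1+m≤n = ≤-trans (s≤s (m⊓n≤m ⌊ n /2⌋ d)) (0<n⇒⌊n/2⌋<n 0<n)

-- Any three vertices of the 4-cycle omit one vertex, hence form an arc of length 2, which is a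
-- shortest path.
C₄-omega : ∀ {d} → 3 ≤ d + 1 → (n≥3 : 4 ≥ 3) → IsOmega 3 d (cycle 4 n≥3) 4
C₄-omega {d} 3≤d+1 n≥3 = maximumClique⇒IsOmega C ⊤ clique (∣⊤∣≡n 4) (λ S _ → ∣p∣≤n S)
  where
  open CycleGraph 4 n≥3

  2≤d : 2 ≤ d
  2≤d = s≤s⁻¹ (≤-trans 3≤d+1 (≤-reflexive (+-comm d 1)))

  clique : IsClique C 3 d ⊤
  clique T _ ∣T∣≡3 with z , z∉T ← missingElement T (s≤s (≤-reflexive ∣T∣≡3)) =
    arc⇒InShortestPath (suc (toℕ z)) T ≤-refl 2≤d (InArc-∌ z∉T)

proposition5p10 : ∀ (k d n : ℕ) → 3 ≤ k → k ≤ d + 1 → (n≥3 : n ≥ 3) →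
    (k ≡ 3 → n ≡ 4 → IsOmega k d (cycle n n≥3) 4)
    ×
    (¬ (k ≡ 3 × n ≡ 4) →
    ( (n ≤ k ∸ 1 → IsOmega k d (cycle n n≥3) n)
    × (n ≥ k → ⌊ n /2⌋ + 1 ≤ k ∸ 1 → IsOmega k d (cycle n n≥3) (k ∸ 1))
    × (⌊ n /2⌋ + 1 > k ∸ 1 → IsOmega k d (cycle n n≥3) ((⌊ n /2⌋ + 1) ⊓ (d + 1))) )
    ×
    ( (n ≤ k ∸ 1 → IsOmega k d (cycle n n≥3) n)
    × (k ≤ n → n ≤ 2 * k ∸ 3 → IsOmega k d (cycle n n≥3) (k ∸ 1))
    × (2 * k ∸ 2 ≤ n → n ≤ 2 * d ∸ 1 → IsOmega k d (cycle n n≥3) (⌊ n /2⌋ + 1))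
    × (n ≥ 2 * d → IsOmega k d (cycle n n≥3) (d + 1)) ))
proposition5p10 (suc k) d n 3≤1+k 1+k≤d+1 n≥3 =
  (λ { refl refl → C₄-omega 1+k≤d+1 n≥3 }) ,
  λ exception →
    let
      -- The matched `k` is one less than the parameter, so `⌊ n /2⌋ + 1 > k ∸ 1` in the statement
      -- unfolds to this hypothesis.
      main : suc k ≤ ⌊ n /2⌋ + 1 → IsOmega (suc k) d C ((⌊ n /2⌋ + 1) ⊓ (d + 1))
      main 1+k≤⌊n/2⌋+1 = arc-omega 3≤1+k 1+k≤d+1 1+k≤⌊n/2⌋+1 exception
    in
    ( (λ n≤k → full-omega (s≤s n≤k)) , small-omega , main ) ,
    ( (λ n≤k → full-omega (s≤s n≤k))
    , (λ 1+k≤n n≤2k∸1 → small-omega 1+k≤n (⌊n/2⌋+1≤k n≤2k∸1))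
    , (λ 2k≤n n≤2d∸1 → subst (IsOmega (suc k) d C)
        (m≤n⇒m⊓n≡m (+-monoˡ-≤ 1 (⌊n/2⌋≤d n≤2d∸1))) (main (1+k≤ (k≤⌊n/2⌋ 2k≤n))))
    -- Here `d ≤ ⌊ n /2⌋`, so the minimum is `d + 1`, and `suc k ≤ d + 1` yields the hypothesis of
    -- `main`.
    , (λ 2d≤n → subst (IsOmega (suc k) d C)
        (m≥n⇒m⊓n≡n (+-monoˡ-≤ 1 (d≤⌊n/2⌋ 2d≤n))) (main (≤-trans 1+k≤d+1 (+-monoˡ-≤ 1 (d≤⌊n/2⌋ 2d≤n))))) )
  where
  open CycleGraph n n≥3

  2*≡+ : ∀ m → 2 * m ≡ m + m
  2*≡+ m = cong (m +_) (+-identityʳ m)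

  2*[1+m]∸2≡ : ∀ m → 2 * suc m ∸ 2 ≡ m + m
  2*[1+m]∸2≡ m = trans (cong (_∸ 2) (2*≡+ (suc m))) (cong (_∸ 1) (+-suc m m))

  1+k≤ : ∀ {m} → k ≤ m → suc k ≤ m + 1
  1+k≤ {m} k≤m = ≤-trans (s≤s k≤m) (≤-reflexive (+-comm 1 m))

  k≤⌊n/2⌋ : 2 * suc k ∸ 2 ≤ n → k ≤ ⌊ n /2⌋
  k≤⌊n/2⌋ 2k≤n = m+m≤n⇒m≤⌊n/2⌋ (≤-trans (≤-reflexive (sym (2*[1+m]∸2≡ k))) 2k≤n)

  d≤⌊n/2⌋ : n ≥ 2 * d → d ≤ ⌊ n /2⌋
  d≤⌊n/2⌋ 2d≤n = m+m≤n⇒m≤⌊n/2⌋ (≤-trans (≤-reflexive (sym (2*≡+ d))) 2d≤n)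

  ⌊n/2⌋≤d : n ≤ 2 * d ∸ 1 → ⌊ n /2⌋ ≤ d
  ⌊n/2⌋≤d n≤2d∸1 = m+m≤n+n⇒m≤n (≤-trans (⌊n/2⌋+⌊n/2⌋≤n n) (≤-trans n≤2d∸1
    (≤-trans (m∸n≤m (2 * d) 1) (≤-reflexive (2*≡+ d)))))

  ⌊n/2⌋+1≤k : n ≤ 2 * suc k ∸ 3 → ⌊ n /2⌋ + 1 ≤ k
  ⌊n/2⌋+1≤k n≤2k∸1 = ≤-trans (≤-reflexive (+-comm ⌊ n /2⌋ 1)) (≰⇒> λ k≤⌊n/2⌋ →
    <⇒≱ 2k∸1<2k (≤-trans (+-mono-≤ k≤⌊n/2⌋ k≤⌊n/2⌋)
      (≤-trans (⌊n/2⌋+⌊n/2⌋≤n n) (≤-trans n≤2k∸1 (≤-reflexive 2k∸1≡)))))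
    where
    2k∸1≡ : 2 * suc k ∸ 3 ≡ k + k ∸ 1
    2k∸1≡ = trans (sym (∸-+-assoc (2 * suc k) 2 1)) (cong (_∸ 1) (2*[1+m]∸2≡ k))

    2k∸1<2k : k + k ∸ 1 < k + k
    -- `k` is positive since `3 ≤ suc k`, so the subtraction is not truncated.
    2k∸1<2k = ≤-reflexive (m+[n∸m]≡n (≤-trans (s≤s z≤n) (≤-trans (s≤s⁻¹ 3≤1+k) (m≤m+n k k))))
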